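{- Let $G$ be an entwined graph such that all odd cycles in $G$ are edge disjoint, and let $r$ be the number of odd cycles in $G$. Then $G$ admits a weak IASI if and only if it has at least $r$ mono-indexed edges.
   Context: All graphs are simple and finite, with no isolated vertices; $\mathbb{N}_0$ denotes the set of non-negative integers. For $A,B\subseteq\mathbb{N}_0$, $A+B=\{a+b: a\in A, b\in B\}$. An integer additive set-indexer (IASI) of a graph $G$ is an injective function $f:V(G)\to 2^{\mathbb{N}_0}$ such that the induced function $g_f:E(G)\to 2^{\mathbb{N}_0}$, $g_f(uv)=f(u)+f(v)$, is also injective. An IASI $f$ is a weak IASI if $|g_f(uv)|=\max(|f(u)|,|f(v)|)$ for every edge $uv$. An element (vertex or edge) whose set-label has cardinality $1$ is called mono-indexed. An entwined graph is a graph that is a union of cycles in which every path appears in at most two cycles and every cycle is attached (shares a common path) with at most two other cycles, so that common paths are shared by exactly two cycles.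
   Formalization: Set-labels are taken to be finite non-empty subsets of the non-negative integers (with infinite labels a triangle has a weak IASI with no mono-indexed edge); the equivalence is read as: every weak IASI has at least r mono-indexed edges, and some weak IASI has exactly r. -}

module Defs where

open import Data.Nat using (ℕ; zero; suc; _+_; _≤_; _<ᵇ_; _⊔_; _≟_)
open import Data.Bool using (Bool; true; false; _∧_)
open import Data.Fin using (Fin; toℕ)
open import Data.List using (List; []; _∷_; length; zip; _++_; [_]; filterᵇ; filter;
                             cartesianProduct; cartesianProductWith; deduplicate; allFin)
open import Data.List.Membership.Propositional using (_∈_)
open import Data.List.Relation.Unary.Unique.Propositional using (Unique)
open import Data.List.Relation.Unary.All using (All)
open import Data.Product using (Σ; ∃; _×_; _,_; proj₁)
open import Data.Sum using (_⊎_)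
open import Relation.Binary.PropositionalEquality using (_≡_; _≢_)
open import Relation.Nullary using (¬_)
open import Function.Bundles using (_⇔_)

record Graph (n : ℕ) : Set where
  field
    adj        : Fin n → Fin n → Bool
    adj-sym    : ∀ u v → adj u v ≡ adj v u
    adj-irrefl : ∀ v → adj v v ≡ false
    noIsolated : ∀ v → ∃ λ u → adj v u ≡ true

open Graph public

Adj : ∀ {n} → Graph n → Fin n → Fin n → Set
Adj G u v = adj G u v ≡ true

edges : ∀ {n} → Graph n → List (Fin n × Fin n)
edges {n} G = filterᵇ (λ { (i , j) → (toℕ i <ᵇ toℕ j) ∧ adj G i j })
                      (cartesianProduct (allFin n) (allFin n))

cyclicPairs : ∀ {A : Set} → List A → List (A × A)
cyclicPairs []       = []
cyclicPairs (x ∷ xs) = zip (x ∷ xs) (xs ++ [ x ])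

record Cycle {n : ℕ} (G : Graph n) : Set where
  field
    verts    : List (Fin n)
    long     : 3 ≤ length verts
    distinct : Unique verts
    closed   : All (λ p → Adj G (proj₁ p) (Data.Product.proj₂ p)) (cyclicPairs verts)

open Cycle public

EdgeOf : ∀ {n} {G : Graph n} → Cycle G → Fin n → Fin n → Set
EdgeOf C u v = ((u , v) ∈ cyclicPairs (verts C)) ⊎ ((v , u) ∈ cyclicPairs (verts C))

-- cycles are identified as subgraphs, i.e. by their edge sets
SameCycle : ∀ {n} {G : Graph n} → Cycle G → Cycle G → Set
SameCycle {n} C D = ∀ (u v : Fin n) → EdgeOf C u v ⇔ EdgeOf D u v

ShareEdge : ∀ {n} {G : Graph n} → Cycle G → Cycle G → Set
ShareEdge {n} C D = Σ (Fin n) λ u → Σ (Fin n) λ v → EdgeOf C u v × EdgeOf D u v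

data Odd : ℕ → Set where
  one  : Odd 1
  odd+2 : ∀ {k} → Odd k → Odd (suc (suc k))

OddCycle : ∀ {n} {G : Graph n} → Cycle G → Set
OddCycle C = Odd (length (verts C))

OddCyclesEdgeDisjoint : ∀ {n} → Graph n → Set
OddCyclesEdgeDisjoint G = ∀ (C D : Cycle G) → OddCycle C → OddCycle D →
                          ShareEdge C D → SameCycle C D

-- Cs is a list of exactly the odd cycles of G, each occurring once
-- (so r = length Cs is the number of odd cycles of G)
ListsOddCycles : ∀ {n} (G : Graph n) → List (Cycle G) → Set
ListsOddCycles G Cs =
  All OddCycle Cs ×
  (∀ (C : Cycle G) → OddCycle C → Σ (Cycle G) λ D → D ∈ Cs × SameCycle C D) ×
  (∀ (i j : Fin (length Cs)) → SameCycle (Data.List.lookup Cs i) (Data.List.lookup Cs j) → i ≡ j)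

-- Entwined graphs: G is the union of a family Ds of (distinct) cycles of G
-- such that every path (with at least one edge; equivalently every edge)
-- lies in at most two cycles of the family, and every cycle of the family
-- shares a common path with at most two other cycles of the family.

Entwined : ∀ {n} → Graph n → Set
Entwined {n} G = Σ (List (Cycle G)) λ Ds →
  let D = Data.List.lookup Ds in
  (∀ (i j : Fin (length Ds)) → SameCycle (D i) (D j) → i ≡ j) ×
  (∀ (u v : Fin n) → Adj G u v → Σ (Fin (length Ds)) λ i → EdgeOf (D i) u v) ×
  (∀ (u v : Fin n) (i j k : Fin (length Ds)) → i ≢ j → j ≢ k → i ≢ k →
     ¬ (EdgeOf (D i) u v × EdgeOf (D j) u v × EdgeOf (D k) u v)) ×
  (∀ (i j k l : Fin (length Ds)) → i ≢ j → i ≢ k → i ≢ l → j ≢ k → j ≢ l → k ≢ l →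
     ¬ (ShareEdge (D i) (D j) × ShareEdge (D i) (D k) × ShareEdge (D i) (D l)))

-- Integer additive set-indexers.  Set-labels are finite non-empty subsets
-- of ℕ, represented by duplicate-free lists; sets are compared
-- extensionally and |A| is the length of the duplicate-free list.

SameSet : List ℕ → List ℕ → Set
SameSet A B = ∀ x → (x ∈ A) ⇔ (x ∈ B)

sumset : List ℕ → List ℕ → List ℕ
sumset A B = deduplicate _≟_ (cartesianProductWith _+_ A B)

record WeakIASI {n : ℕ} (G : Graph n) : Set where
  field
    label    : Fin n → List ℕ
    finset   : ∀ v → Unique (label v)
    nonempty : ∀ v → 1 ≤ length (label v)
    injV     : ∀ u v → SameSet (label u) (label v) → u ≡ v
    injE     : ∀ u v u' v' → Adj G u v → Adj G u' v' →
               SameSet (sumset (label u) (label v)) (sumset (label u') (label v')) →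
               (u ≡ u' × v ≡ v') ⊎ (u ≡ v' × v ≡ u')
    weak     : ∀ u v → Adj G u v →
               length (sumset (label u) (label v)) ≡ length (label u) ⊔ length (label v)

open WeakIASI public

monoEdges : ∀ {n} {G : Graph n} → WeakIASI G → ℕ
monoEdges {G = G} f =
  length (filter (λ { (u , v) → length (sumset (label f u) (label f v)) ≟ 1 }) (edges G))

{-# OPTIONS --safe #-}

-- In a weak IASI the vertices with non-singleton labels form an independent set, because
-- |A + B| > max(|A|, |B|) as soon as |A|, |B| ≥ 2.  An odd cycle therefore has a
-- mono-indexed edge, and disjointness gives at least one per odd cycle.
--
-- For the converse, layer G by the distance to a root of each component.  Call an edge
-- horizontal if its ends have equal depth, vertical otherwise.  Vertical edges form a
-- bipartite graph, so a vertical path joining the ends of a horizontal edge xy closes up to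
-- an odd cycle whose only horizontal edge is xy; by disjointness this cycle is unique.  Hence
-- x has a single parent, lies on a single horizontal edge, and its parent edge separates x
-- from y in the vertical graph.  Now choose an independent set S from the roots downwards: a
-- vertex is in S iff its parent is not, except that the smaller end of a horizontal edge is
-- never in S.  Uniqueness makes this independent of the choice of parents, and exactly one
-- edge on the odd cycle of xy misses S: either xy or the parent edge of its smaller end.
-- Labels {2^v} off S and {2^v, 2^v + 1} on S give the set-indexer.

module Submission where

open import Defs
open import Data.Bool using (Bool; true; false; not; if_then_else_)
import Data.Bool.Properties as Bool
open import Data.Empty using (⊥)
open import Data.Fin using (Fin; toℕ; zero; suc)
open import Data.Fin.Properties using (toℕ-injective; injective⇒≤; any?) renaming (_≟_ to _≟ᶠ_)
open import Data.List using (List; []; _∷_; length; lookup; map; zip; _++_; [_]; filter; cartesianProduct; cartesianProductWith; allFin)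
open import Data.List.Membership.Propositional using (_∈_; _∉_; find)
open import Data.List.Membership.Propositional.Properties using (∈-lookup; ∈-map⁻; ∈-filter⁺; ∈-filter⁻; ∈-cartesianProduct⁺; ∈-cartesianProductWith⁺; ∈-cartesianProductWith⁻; ∈-deduplicate⁺; ∈-deduplicate⁻; ∈-allFin)
open import Data.List.Properties using (length-map; filter-accept; filter-≐)
open import Data.List.Relation.Unary.All as All using (All; []; _∷_)
open import Data.List.Relation.Unary.All.Properties using (¬Any⇒All¬)
open import Data.List.Relation.Unary.Any as Any using (here; there)
open import Data.List.Relation.Unary.Any.Properties using (lookup-index)
open import Data.List.Relation.Unary.AllPairs using ([]; _∷_)
open import Data.List.Relation.Unary.Unique.Propositional using (Unique)
import Data.List.Relation.Unary.Unique.Propositional.Properties as Unique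
open import Data.Nat using (ℕ; zero; suc; _+_; _^_; _⊔_; _≤_; _<_; _≟_; _<?_; z≤n; s≤s; s≤s⁻¹)
open import Data.Nat.Properties
open import Data.Product using (Σ; ∃; ∃₂; _×_; _,_; proj₁; proj₂)
open import Data.Sum using (_⊎_; inj₁; inj₂; [_,_]′)
open import Function using (_∘_; id; case_of_)
open import Function.Bundles using (Equivalence)
open import Relation.Binary.Construct.Closure.ReflexiveTransitive as Star using (Star; ε; _◅_; _◅◅_)
open import Relation.Binary.Definitions using (tri<; tri≈; tri>; Symmetric)
open import Relation.Binary.PropositionalEquality using (_≡_; _≢_; refl; sym; trans; cong; subst)
open import Relation.Nullary using (¬_; Dec; yes; no; does; contradiction; ¬?)
open import Relation.Nullary.Decidable using (dec-true; dec-false; _×-dec_; _⊎-dec_)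
open import Relation.Unary using (Decidable)

-- Counting by injections into `Fin`.

lookup-injective : ∀ {A : Set} {xs : List A} → Unique xs →
                   ∀ i j → lookup xs i ≡ lookup xs j → i ≡ j
lookup-injective (_ ∷ _)  zero    zero    _  = refl
lookup-injective (x∉ ∷ _) zero    (suc j) eq = contradiction eq (All.lookup x∉ (∈-lookup j))
lookup-injective (x∉ ∷ _) (suc i) zero    eq = contradiction (sym eq) (All.lookup x∉ (∈-lookup i))
lookup-injective (_ ∷ u)  (suc i) (suc j) eq = cong suc (lookup-injective u i j eq)

index-injective : ∀ {A : Set} {xs : List A} {x y : A} (x∈ : x ∈ xs) (y∈ : y ∈ xs) →
                  Any.index x∈ ≡ Any.index y∈ → x ≡ y
index-injective {xs = xs} x∈ y∈ eq =
  trans (lookup-index x∈) (trans (cong (lookup xs) eq) (sym (lookup-index y∈)))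

-- The map may depend on the membership proof, as `Any.index` does, so injectivity is asked for up
-- to equality of elements only.
Unique⇒length≤ : ∀ {A : Set} {m} {xs : List A} → Unique xs → (f : ∀ {x} → x ∈ xs → Fin m) →
                 (∀ {x y} (x∈ : x ∈ xs) (y∈ : y ∈ xs) → f x∈ ≡ f y∈ → x ≡ y) → length xs ≤ m
Unique⇒length≤ u f f-inj =
  injective⇒≤ {f = λ i → f (∈-lookup i)} λ {i} {j} eq →
    lookup-injective u i j (f-inj (∈-lookup i) (∈-lookup j) eq)

-- Sumsets

max-∈ : (A : List ℕ) → 1 ≤ length A → ∃ λ m → m ∈ A × (∀ {x} → x ∈ A → x ≤ m)
max-∈ (a ∷ [])          _ = a , here refl , λ { (here refl) → ≤-refl }
max-∈ (a ∷ A@(_ ∷ _)) _ with max-∈ A (s≤s z≤n)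
... | m , m∈ , m-max with ≤-total a m
... | inj₁ a≤m = m , there m∈ , λ { (here refl) → a≤m ; (there x∈) → m-max x∈ }
... | inj₂ m≤a = a , here refl , λ { (here refl) → ≤-refl ; (there x∈) → ≤-trans (m-max x∈) m≤a }

two-elements : {B : List ℕ} → Unique B → 2 ≤ length B → ∃₂ λ b b′ → b ∈ B × b′ ∈ B × b < b′
two-elements {b ∷ b′ ∷ _} ((b≢b′ ∷ _) ∷ _) _ with <-cmp b b′
... | tri< b<b′ _ _ = b , b′ , here refl , there (here refl) , b<b′
... | tri≈ _ b≡b′ _ = contradiction b≡b′ b≢b′
... | tri> _ _ b′<b = b′ , b , there (here refl) , here refl , b′<b
two-elements {[]}     _ ()
two-elements {_ ∷ []} _ (s≤s ())

-- The translate A + b, where b < b′ in B, misses max A + b′.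
length<sums : {A B C : List ℕ} → Unique A → Unique B → 1 ≤ length A → 2 ≤ length B →
              (∀ {a b} → a ∈ A → b ∈ B → a + b ∈ C) → length A < length C
length<sums {A} {B} {C} uA uB 1≤A 2≤B sums
  with max-∈ A 1≤A | two-elements uB 2≤B
... | m , m∈ , m-max | b , b′ , b∈ , b′∈ , b<b′ =
  subst (λ l → suc l ≤ length C) (length-map (_+ b) A)
    (Unique⇒length≤ unique (Any.index ∘ ⊆C) (λ x∈ y∈ → index-injective (⊆C x∈) (⊆C y∈)))
  where
  unique : Unique (m + b′ ∷ map (_+ b) A)
  unique = All.tabulate (λ x∈ eq → case ∈-map⁻ (_+ b) x∈ of λ where
             (a , a∈ , refl) → <⇒≢ (+-mono-≤-< (m-max a∈) b<b′) (sym eq))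
           ∷ Unique.map⁺ (+-cancelʳ-≡ b _ _) uA

  ⊆C : ∀ {x} → x ∈ m + b′ ∷ map (_+ b) A → x ∈ C
  ⊆C (here refl) = sums m∈ b′∈
  ⊆C (there x∈) with ∈-map⁻ (_+ b) x∈
  ... | a , a∈ , refl = sums a∈ b∈

∈-sumset⁺ : ∀ {A B a b} → a ∈ A → b ∈ B → a + b ∈ sumset A B
∈-sumset⁺ a∈ b∈ = ∈-deduplicate⁺ _≟_ (∈-cartesianProductWith⁺ _+_ a∈ b∈)

∈-sumset⁻ : ∀ A B {s} → s ∈ sumset A B → ∃₂ λ a b → a ∈ A × b ∈ B × s ≡ a + b
∈-sumset⁻ A B s∈ = ∈-cartesianProductWith⁻ _+_ A B (∈-deduplicate⁻ _≟_ (cartesianProductWith _+_ A B) s∈)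

weak⇒mono : {A B : List ℕ} → Unique A → Unique B →
            length (sumset A B) ≡ length A ⊔ length B → ¬ (2 ≤ length A × 2 ≤ length B)
weak⇒mono {A} {B} uA uB w (2≤A , 2≤B) = <-irrefl (sym w) (⊔-lub A< B<)
  where
  A< : length A < length (sumset A B)
  A< = length<sums uA uB (<⇒≤ 2≤A) 2≤B ∈-sumset⁺
  B< : length B < length (sumset A B)
  B< = length<sums uB uA (<⇒≤ 2≤B) 2≤A λ {b} {a} b∈ a∈ →
         subst (_∈ sumset A B) (+-comm a b) (∈-sumset⁺ a∈ b∈)

length-sumset-pairˡ : ∀ a b → length (sumset (a ∷ suc a ∷ []) [ b ]) ≡ 2
length-sumset-pairˡ a b = cong (suc ∘ length)
  (filter-accept (¬? ∘ (a + b ≟_)) {xs = []} (<⇒≢ (n<1+n (a + b))))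

length-sumset-pairʳ : ∀ a b → length (sumset [ a ] (b ∷ suc b ∷ [])) ≡ 2
length-sumset-pairʳ a b = cong (suc ∘ length)
  (filter-accept (¬? ∘ (a + b ≟_)) {xs = []} (<⇒≢ (+-monoʳ-< a (n<1+n b))))

IsMin : ℕ → List ℕ → Set
IsMin m A = m ∈ A × (∀ {x} → x ∈ A → m ≤ x)

IsMin-unique : ∀ {A B m m′} → SameSet A B → IsMin m A → IsMin m′ B → m ≡ m′
IsMin-unique same (m∈ , m-min) (m′∈ , m′-min) =
  ≤-antisym (m-min (Equivalence.from (same _) m′∈)) (m′-min (Equivalence.to (same _) m∈))

-- The smallest sum comes from the two smallest elements. With powers of 2 as minima this recovers
-- an edge from its label, whatever the cardinalities.
IsMin-sumset : ∀ {A B a b} → IsMin a A → IsMin b B → IsMin (a + b) (sumset A B)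
IsMin-sumset {A} {B} (a∈ , a-min) (b∈ , b-min) = ∈-sumset⁺ a∈ b∈ , λ s∈ →
  case ∈-sumset⁻ A B s∈ of λ where
    (_ , _ , x∈ , y∈ , refl) → +-mono-≤ (a-min x∈) (b-min y∈)

-- The labelling attached to an independent set

2^-injective : ∀ {i j} → 2 ^ i ≡ 2 ^ j → i ≡ j
2^-injective {i} {j} eq with <-cmp i j
... | tri< i<j _ _ = contradiction eq (<⇒≢ (^-monoʳ-< 2 (n<1+n 1) i<j))
... | tri≈ _ i≡j _ = i≡j
... | tri> _ _ j<i = contradiction (sym eq) (<⇒≢ (^-monoʳ-< 2 (n<1+n 1) j<i))

2^+2^<2^ : ∀ {i j k} → i < j → j < k → 2 ^ i + 2 ^ j < 2 ^ k
2^+2^<2^ {i} {j} {k} i<j j<k = begin-strict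
  2 ^ i + 2 ^ j ≡⟨ +-comm (2 ^ i) (2 ^ j) ⟩
  2 ^ j + 2 ^ i <⟨ +-monoʳ-< (2 ^ j) (^-monoʳ-< 2 (n<1+n 1) i<j) ⟩
  2 ^ j + 2 ^ j ≡⟨ cong (2 ^ j +_) (+-identityʳ (2 ^ j)) ⟨
  2 ^ suc j     ≤⟨ ^-monoʳ-≤ 2 j<k ⟩
  2 ^ k         ∎
  where open ≤-Reasoning

-- If the larger exponents differed, the sum with the smaller one would stay below the leading power
-- of the other; once they agree, cancellation applies.
2^+2^-injective-< : ∀ {i j i′ j′} → i < j → i′ < j′ →
                    2 ^ i + 2 ^ j ≡ 2 ^ i′ + 2 ^ j′ → i ≡ i′ × j ≡ j′
2^+2^-injective-< {i} {j} {i′} {j′} i<j i′<j′ eq with <-cmp j j′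
... | tri< j<j′ _ _ = contradiction eq (<⇒≢ (<-≤-trans (2^+2^<2^ i<j j<j′) (m≤n+m (2 ^ j′) (2 ^ i′))))
... | tri≈ _ refl _ = 2^-injective (+-cancelʳ-≡ (2 ^ j) (2 ^ i) (2 ^ i′) eq) , refl
... | tri> _ _ j′<j = contradiction (sym eq) (<⇒≢ (<-≤-trans (2^+2^<2^ i′<j′ j′<j) (m≤n+m (2 ^ j) (2 ^ i))))

SameEdge : {V : Set} → V → V → V → V → Set
SameEdge u v u′ v′ = (u ≡ u′ × v ≡ v′) ⊎ (u ≡ v′ × v ≡ u′)

2^+2^-injective : ∀ {i j i′ j′} → i ≢ j → i′ ≢ j′ →
                  2 ^ i + 2 ^ j ≡ 2 ^ i′ + 2 ^ j′ → SameEdge i j i′ j′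
2^+2^-injective {i} {j} {i′} {j′} i≢j i′≢j′ eq with <-cmp i j | <-cmp i′ j′
... | tri≈ _ i≡j _ | _ = contradiction i≡j i≢j
... | _ | tri≈ _ i′≡j′ _ = contradiction i′≡j′ i′≢j′
... | tri< i<j _ _ | tri< i′<j′ _ _ = inj₁ (2^+2^-injective-< i<j i′<j′ eq)
... | tri< i<j _ _ | tri> _ _ j′<i′ =
  inj₂ (2^+2^-injective-< i<j j′<i′ (trans eq (+-comm (2 ^ i′) (2 ^ j′))))
... | tri> _ _ j<i | tri< i′<j′ _ _ =
  let j≡i′ , i≡j′ = 2^+2^-injective-< j<i i′<j′ (trans (+-comm (2 ^ j) (2 ^ i)) eq)
  in inj₂ (i≡j′ , j≡i′)
... | tri> _ _ j<i | tri> _ _ j′<i′ =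
  let j≡j′ , i≡i′ = 2^+2^-injective-< j<i j′<i′
                      (trans (+-comm (2 ^ j) (2 ^ i)) (trans eq (+-comm (2 ^ i′) (2 ^ j′))))
  in inj₁ (i≡i′ , j≡j′)

Adj⇒≢ : ∀ {n} (G : Graph n) {u v} → Adj G u v → u ≢ v
Adj⇒≢ G {u} uv refl with () ← trans (sym uv) (adj-irrefl G u)

Adj-sym : ∀ {n} (G : Graph n) {u v} → Adj G u v → Adj G v u
Adj-sym G {u} {v} uv = trans (adj-sym G v u) uv

module IndependentLabelling {n} (G : Graph n) (S : Fin n → Bool)
         (independent : ∀ {u v} → Adj G u v → S u ≡ true → S v ≡ true → ⊥) where

  -- Both shapes have minimum `a`, so labels remain distinguishable by their minima alone.
  labelOf : Bool → ℕ → List ℕ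
  labelOf false a = [ a ]
  labelOf true  a = a ∷ suc a ∷ []

  labelOf-unique : ∀ b a → Unique (labelOf b a)
  labelOf-unique false a = [] ∷ []
  labelOf-unique true  a = (<⇒≢ (n<1+n a) ∷ []) ∷ [] ∷ []

  labelOf-min : ∀ b a → IsMin a (labelOf b a)
  labelOf-min false a = here refl , λ { (here refl) → ≤-refl }
  labelOf-min true  a = here refl , λ { (here refl) → ≤-refl ; (there (here refl)) → n≤1+n a }

  labelOf-weak : ∀ b b′ x y → ¬ (b ≡ true × b′ ≡ true) →
    length (sumset (labelOf b x) (labelOf b′ y)) ≡ length (labelOf b x) ⊔ length (labelOf b′ y)
  labelOf-weak false false x y _ = refl
  labelOf-weak false true  x y _ = length-sumset-pairʳ x y
  labelOf-weak true  false x y _ = length-sumset-pairˡ x y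
  labelOf-weak true  true  x y ¬both = contradiction (refl , refl) ¬both

  labelling : WeakIASI G
  labelling = record
    { label    = λ v → labelOf (S v) (2 ^ toℕ v)
    ; finset   = λ v → labelOf-unique (S v) _
    ; nonempty = λ v → 1≤ (S v)
    ; injV     = λ u v same → toℕ-injective (2^-injective (IsMin-unique same (min u) (min v)))
    ; injE     = λ u v u′ v′ uv u′v′ same → toℕ-SameEdge
        (2^+2^-injective (Adj⇒≢ G uv ∘ toℕ-injective) (Adj⇒≢ G u′v′ ∘ toℕ-injective)
          (IsMin-unique same (IsMin-sumset (min u) (min v)) (IsMin-sumset (min u′) (min v′))))
    ; weak     = λ u v uv → labelOf-weak (S u) (S v) _ _ λ (Su , Sv) → independent uv Su Sv
    }
    where
    1≤ : ∀ b {a} → 1 ≤ length (labelOf b a)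
    1≤ false = s≤s z≤n
    1≤ true  = s≤s z≤n
    min : ∀ v → IsMin (2 ^ toℕ v) (labelOf (S v) (2 ^ toℕ v))
    min v = labelOf-min (S v) _
    toℕ-SameEdge : {u v u′ v′ : Fin n} → SameEdge (toℕ u) (toℕ v) (toℕ u′) (toℕ v′) → SameEdge u v u′ v′
    toℕ-SameEdge (inj₁ (p , q)) = inj₁ (toℕ-injective p , toℕ-injective q)
    toℕ-SameEdge (inj₂ (p , q)) = inj₂ (toℕ-injective p , toℕ-injective q)

  mono⇒false : ∀ {u v} → Adj G u v → length (sumset (label labelling u) (label labelling v)) ≡ 1 →
               S u ≡ false × S v ≡ false
  mono⇒false {u} {v} uv eq with S u | S v | trans (sym (weak labelling u v uv)) eq
  ... | false | false | _ = refl , refl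
  ... | false | true  | ()
  ... | true  | false | ()
  ... | true  | true  | ()

-- Edge lists

-- The filter of `monoEdges` with its predicate restated through projections; the pattern-matching
-- lambda there is a different function, hence the use of `filter-≐` below.
monoEdgeList : ∀ {n} {G : Graph n} → WeakIASI G → List (Fin n × Fin n)
monoEdgeList {G = G} f =
  filter (λ e → length (sumset (label f (proj₁ e)) (label f (proj₂ e))) ≟ 1) (edges G)

monoEdges≡ : ∀ {n} {G : Graph n} (f : WeakIASI G) → monoEdges f ≡ length (monoEdgeList f)
monoEdges≡ {G = G} f = cong length (filter-≐ _ _ (id , id) (edges G))

∈-edges⁺ : ∀ {n} (G : Graph n) {u v} → Adj G u v → toℕ u < toℕ v → (u , v) ∈ edges G
∈-edges⁺ G {u} {v} uv u<v = ∈-filter⁺ _ (∈-cartesianProduct⁺ (∈-allFin u) (∈-allFin v))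
  (Equivalence.from Bool.T-∧ (<⇒<ᵇ u<v , Equivalence.from Bool.T-≡ uv))

∈-edges⁻ : ∀ {n} (G : Graph n) {u v} → (u , v) ∈ edges G → Adj G u v × toℕ u < toℕ v
∈-edges⁻ {n} G uv∈ =
  let u<v , uv = Equivalence.to Bool.T-∧
                   (proj₂ (∈-filter⁻ _ {xs = cartesianProduct (allFin n) (allFin n)} uv∈))
  in Equivalence.to Bool.T-≡ uv , <ᵇ⇒< _ _ u<v

∈-monoEdgeList⁺ : ∀ {n} {G : Graph n} (f : WeakIASI G) {u v} → (u , v) ∈ edges G →
                  length (sumset (label f u) (label f v)) ≡ 1 → (u , v) ∈ monoEdgeList f
∈-monoEdgeList⁺ f = ∈-filter⁺ _

∈-monoEdgeList⁻ : ∀ {n} {G : Graph n} (f : WeakIASI G) {u v} → (u , v) ∈ monoEdgeList f →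
                  (u , v) ∈ edges G × length (sumset (label f u) (label f v)) ≡ 1
∈-monoEdgeList⁻ f = ∈-filter⁻ _

monoEdgeList-unique : ∀ {n} {G : Graph n} (f : WeakIASI G) → Unique (monoEdgeList f)
monoEdgeList-unique {n} f = Unique.filter⁺ _ (Unique.filter⁺ _
  (Unique.cartesianProduct⁺ (Unique.allFin⁺ n) (Unique.allFin⁺ n)))

-- Odd cycles contain mono-indexed edges

≢-≢⇒≡ : {a b c : Bool} → a ≢ b → b ≢ c → a ≡ c
≢-≢⇒≡ a≢b b≢c = trans (Bool.¬-not a≢b) (sym (Bool.¬-not (b≢c ∘ sym)))

-- Two alternating steps restore the colour, so vertices can be removed in pairs. The closing vertex
-- `z` is kept apart from `x` because the induction moves the head.
odd-alternating : {A : Set} (S : A → Bool) (x z : A) (xs : List A) → Odd (length (x ∷ xs)) →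
                  All (λ p → S (proj₁ p) ≢ S (proj₂ p)) (zip (x ∷ xs) (xs ++ [ z ])) → S x ≢ S z
odd-alternating S x z []           one       (x≢z ∷ _)         = x≢z
odd-alternating S x z (y ∷ w ∷ xs) (odd+2 o) (x≢y ∷ y≢w ∷ alt) =
  odd-alternating S w z xs o alt ∘ trans (sym (≢-≢⇒≡ x≢y y≢w))

odd-monochromatic : {A : Set} (S : A → Bool) (xs : List A) → Odd (length xs) →
                    ¬ All (λ p → S (proj₁ p) ≢ S (proj₂ p)) (cyclicPairs xs)
odd-monochromatic S []       ()
odd-monochromatic S (x ∷ xs) o alt = odd-alternating S x x xs o alt refl

EdgeOf-sym : ∀ {n} {G : Graph n} (C : Cycle G) {u v} → EdgeOf C u v → EdgeOf C v u
EdgeOf-sym C (inj₁ uv) = inj₂ uv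
EdgeOf-sym C (inj₂ vu) = inj₁ vu

module LowerBound {n} {G : Graph n} (f : WeakIASI G) where

  MonoEdge : Fin n → Fin n → Set
  MonoEdge u v = length (sumset (label f u) (label f v)) ≡ 1

  MonoEdge-sym : ∀ {u v} → Adj G u v → MonoEdge u v → MonoEdge v u
  MonoEdge-sym {u} {v} uv mono =
    trans (weak f v u (Adj-sym G uv))
      (trans (⊔-comm (length (label f v)) _) (trans (sym (weak f u v uv)) mono))

  singleton : Fin n → Bool
  singleton v = does (length (label f v) ≟ 1)

  -- Two singletons would give a mono-indexed edge, and two larger labels are excluded by
  -- `weak⇒mono`.
  singleton-alternates : ∀ {u v} → Adj G u v → ¬ MonoEdge u v → singleton u ≢ singleton v
  singleton-alternates {u} {v} uv ¬mono eq
    with length (label f u) ≟ 1 | length (label f v) ≟ 1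
  ... | yes lu | yes lv = ¬mono (trans (weak f u v uv)
          (trans (cong (_⊔ length (label f v)) lu) (cong (1 ⊔_) lv)))
  ... | no lu  | no lv  = weak⇒mono (finset f u) (finset f v) (weak f u v uv)
          (≤∧≢⇒< (nonempty f u) (lu ∘ sym) , ≤∧≢⇒< (nonempty f v) (lv ∘ sym))
  ... | yes lu | no lv with () ← trans (sym (dec-true (_ ≟ 1) lu)) (trans eq (dec-false (_ ≟ 1) lv))
  ... | no lu | yes lv with () ← trans (sym (dec-true (_ ≟ 1) lv)) (trans (sym eq) (dec-false (_ ≟ 1) lu))

  -- Otherwise `singleton` would properly 2-colour an odd cycle. The orientation `toℕ u < toℕ v` is
  -- the one under which `edges` lists the edge.
  odd⇒monoEdge : (C : Cycle G) → OddCycle C →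
                 ∃₂ λ u v → EdgeOf C u v × MonoEdge u v × Adj G u v × toℕ u < toℕ v
  odd⇒monoEdge C odd
    with Any.any? (λ p → length (sumset (label f (proj₁ p)) (label f (proj₂ p))) ≟ 1)
           (cyclicPairs (verts C))
  ... | no none = contradiction
          (All.zipWith (λ (uv , ¬mono) → singleton-alternates uv ¬mono) (closed C , ¬Any⇒All¬ _ none))
          (odd-monochromatic singleton (verts C) odd)
  ... | yes some with find some
  ... | (u , v) , uv∈ , mono with All.lookup (closed C) uv∈
  ... | uv with <-cmp (toℕ u) (toℕ v)
  ... | tri< u<v _ _ = u , v , inj₁ uv∈ , mono , uv , u<v
  ... | tri≈ _ u≡v _ = contradiction (toℕ-injective u≡v) (Adj⇒≢ G uv)
  ... | tri> _ _ v<u = v , u , inj₂ uv∈ , MonoEdge-sym uv mono , Adj-sym G uv , v<u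

  -- One mono-indexed edge is chosen on each odd cycle; two cycles with the same chosen edge
  -- coincide by disjointness.
  oddCycles≤monoEdges : OddCyclesEdgeDisjoint G → (Cs : List (Cycle G)) → All OddCycle Cs →
    (∀ i j → SameCycle (lookup Cs i) (lookup Cs j) → i ≡ j) → length Cs ≤ monoEdges f
  oddCycles≤monoEdges disjoint Cs odd distinct =
    subst (length Cs ≤_) (sym (monoEdges≡ f)) (injective⇒≤ {f = Any.index ∘ edge∈} inj)
    where
    odd-at : ∀ i → OddCycle (lookup Cs i)
    odd-at i = All.lookup odd (∈-lookup i)
    edge : Fin (length Cs) → Fin n × Fin n
    edge i = let u , v , _ = odd⇒monoEdge (lookup Cs i) (odd-at i) in u , v
    edge∈ : ∀ i → edge i ∈ monoEdgeList f
    edge∈ i = let _ , _ , _ , mono , uv , u<v = odd⇒monoEdge (lookup Cs i) (odd-at i) in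
      ∈-monoEdgeList⁺ f (∈-edges⁺ G uv u<v) mono
    edgeOf : ∀ i → EdgeOf (lookup Cs i) (proj₁ (edge i)) (proj₂ (edge i))
    edgeOf i = proj₁ (proj₂ (proj₂ (odd⇒monoEdge (lookup Cs i) (odd-at i))))
    inj : ∀ {i j} → Any.index (edge∈ i) ≡ Any.index (edge∈ j) → i ≡ j
    inj {i} {j} eq = distinct i j (disjoint (lookup Cs i) (lookup Cs j) (odd-at i) (odd-at j)
      (_ , _ , edgeOf i , subst (λ e → EdgeOf (lookup Cs j) (proj₁ e) (proj₂ e))
                            (sym (index-injective (edge∈ i) (edge∈ j) eq)) (edgeOf j)))

-- Simple paths

-- The list omits the starting vertex, so `u ∷ vs` is the vertex list of the cycle obtained by
-- closing the path.
data Path {n} (R : Fin n → Fin n → Set) : Fin n → List (Fin n) → Fin n → Set where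
  []   : ∀ {x} → Path R x [] x
  step : ∀ {u v w vs} → R u v → u ∉ v ∷ vs → Path R v vs w → Path R u (v ∷ vs) w

module _ {n} {R : Fin n → Fin n → Set} where

  suffix : ∀ {v vs w u} → Path R v vs w → u ∈ v ∷ vs → ∃ λ us → Path R u us w
  suffix p            (here refl) = _ , p
  suffix (step _ _ p) (there u∈)  = suffix p u∈

  -- Loop erasure: if the new start already lies on the path, everything before that occurrence is
  -- dropped.
  Star⇒Path : ∀ {u w} → Star R u w → ∃ λ vs → Path R u vs w
  Star⇒Path ε = _ , []
  Star⇒Path {u} (_◅_ {j = v} r rs) with Star⇒Path rs
  ... | vs , p with Any.any? (u ≟ᶠ_) (v ∷ vs)
  ... | yes u∈ = suffix p u∈
  ... | no u∉  = _ , step r u∉ p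

  Path-unique : ∀ {u vs w} → Path R u vs w → Unique (u ∷ vs)
  Path-unique []            = [] ∷ []
  Path-unique (step _ u∉ p) = ¬Any⇒All¬ _ u∉ ∷ Path-unique p

  -- For `z` equal to `u` the zipped list is `cyclicPairs (u ∷ vs)`, with `(w , z)` as closing edge;
  -- `z` is general because the induction moves `u`.
  Path-pairs : ∀ {u vs w} z → Path R u vs w →
               All (λ e → R (proj₁ e) (proj₂ e) ⊎ e ≡ (w , z)) (zip (u ∷ vs) (vs ++ [ z ]))
  Path-pairs z []           = inj₂ refl ∷ []
  Path-pairs z (step r _ p) = inj₁ r ∷ Path-pairs z p

  Path-closing : ∀ {u vs w} z → Path R u vs w → (w , z) ∈ zip (u ∷ vs) (vs ++ [ z ])
  Path-closing z []           = here refl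
  Path-closing z (step _ _ p) = there (Path-closing z p)

  Path⇒Star : ∀ {u vs w} z → Path R u vs w →
              Star (λ a b → R a b × (a , b) ∈ zip (u ∷ vs) (vs ++ [ z ])) u w
  Path⇒Star z []           = ε
  Path⇒Star z (step r _ p) = (r , here refl) ◅ Star.map (λ (s , e) → s , there e) (Path⇒Star z p)

  -- Equal colours at the ends force an even number of edges, hence an odd number of vertices.
  Path-odd : (S : Fin n → Bool) → (∀ {u v} → R u v → S u ≢ S v) →
             ∀ {u vs w} → Path R u vs w → S u ≡ S w → Odd (suc (length vs))
  Path-odd S alt []                          eq = one
  Path-odd S alt (step r _ [])               eq = contradiction eq (alt r)
  Path-odd S alt (step r _ (step r′ _ p)) eq =
    odd+2 (Path-odd S alt p (trans (sym (≢-≢⇒≡ (alt r) (alt r′))) eq))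

-- Odd cycles closed up by a given edge.

record OddCycleThrough {n} (G : Graph n) (R : Fin n → Fin n → Set) (x y : Fin n) : Set where
  field
    cycle   : Cycle G
    odd     : OddCycle cycle
    closing : EdgeOf cycle x y
    edge⇒R  : ∀ {u v} → EdgeOf cycle u v → R u v ⊎ SameEdge u v x y
    first   : ∃ λ q → R x q × EdgeOf cycle x q
    path    : Star (λ u v → R u v × EdgeOf cycle u v) x y

-- Erasing loops from the walk leaves a simple path, which `xy` closes up. Its edges all come from
-- `R`, so the choice of `R` can force the cycle through an edge or keep it away from one.
oddCycleThrough : ∀ {n} (G : Graph n) {R : Fin n → Fin n → Set} → Symmetric R →
  (∀ {u v} → R u v → Adj G u v) →
  (S : Fin n → Bool) → (∀ {u v} → R u v → S u ≢ S v) →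
  ∀ {x y} → Adj G x y → S x ≡ S y → Star R x y → OddCycleThrough G R x y
oddCycleThrough G {R} R-sym R⇒Adj S alt {x} {y} xy Sx≡Sy walk with Star⇒Path walk
-- A path without edges would give `x ≡ y`, and a single edge would change the colour; the remaining
-- case has at least three vertices.
... | _ , []                 = contradiction refl (Adj⇒≢ G xy)
... | _ , step r _ []        = contradiction Sx≡Sy (alt r)
... | _ , p@(step {v = q} {vs = vs} r _ (step _ _ _)) = record
  { cycle   = C
  ; odd     = Path-odd S alt p Sx≡Sy
  ; closing = inj₂ (Path-closing x p)
  ; edge⇒R  = λ where
      (inj₁ uv∈) → case All.lookup (Path-pairs x p) uv∈ of λ where
        (inj₁ r)    → inj₁ r
        (inj₂ refl) → inj₂ (inj₂ (refl , refl))
      (inj₂ vu∈) → case All.lookup (Path-pairs x p) vu∈ of λ where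
        (inj₁ r)    → inj₁ (R-sym r)
        (inj₂ refl) → inj₂ (inj₁ (refl , refl))
  ; first   = q , r , inj₁ (here refl)
  ; path    = Star.map (λ (r , e) → r , inj₁ e) (Path⇒Star x p)
  }
  where
  C : Cycle G
  C = record
    { verts    = x ∷ q ∷ vs
    ; long     = s≤s (s≤s (s≤s z≤n))
    ; distinct = Path-unique p
    ; closed   = All.map (λ { (inj₁ r) → R⇒Adj r ; (inj₂ refl) → Adj-sym G xy }) (Path-pairs x p)
    }

-- Breadth-first layerings

least : {P : ℕ → Set} → Decidable P → ∀ m → P m → ∃ λ k → P k × (∀ {j} → P j → k ≤ j)
least P? m pm with P? 0
... | yes p0 = 0 , p0 , λ _ → z≤n
least P? zero    pm | no ¬p0 = contradiction pm ¬p0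
least P? (suc m) pm | no ¬p0 with least (P? ∘ suc) m pm
... | k , pk , k-min = suc k , pk , λ {j} → minimal j
  where
  minimal : ∀ j → _ → suc k ≤ j
  minimal zero    p = contradiction p ¬p0
  minimal (suc j) p = s≤s (k-min p)

-- `parent` is total but constrained at positive depth only.
record Layering {n} (G : Graph n) : Set where
  field
    depth      : Fin n → ℕ
    root       : Fin n → Fin n
    parent     : Fin n → Fin n
    root-adj   : ∀ {u v} → Adj G u v → root u ≡ root v
    depth-adj  : ∀ {u v} → Adj G u v → depth v ≤ suc (depth u)
    depth-zero : ∀ {v} → depth v ≡ 0 → v ≡ root v
    parent-adj : ∀ {v k} → depth v ≡ suc k → Adj G v (parent v)
    depth-parent : ∀ {v k} → depth v ≡ suc k → depth (parent v) ≡ k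

module _ {n} (G : Graph n) where

  -- Walks of length at most `k`; recursion on the bound makes reachability decidable by finite
  -- search.
  Within : ℕ → Fin n → Fin n → Set
  Within zero    v r = v ≡ r
  Within (suc k) v r = Within k v r ⊎ ∃ λ u → Adj G v u × Within k u r

  within? : ∀ k v r → Dec (Within k v r)
  within? zero    v r = v ≟ᶠ r
  within? (suc k) v r = within? k v r ⊎-dec any? λ u → (adj G v u Bool.≟ true) ×-dec within? k u r

  Within-mono : ∀ {k l v r} → k ≤ l → Within k v r → Within l v r
  Within-mono {l = zero}  z≤n       w = w
  Within-mono {l = suc l} z≤n       w = inj₁ (Within-mono {l = l} z≤n w)
  Within-mono             (s≤s k≤l) (inj₁ w)           = inj₁ (Within-mono k≤l w)
  Within-mono             (s≤s k≤l) (inj₂ (u , a , w)) = inj₂ (u , a , Within-mono k≤l w)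

  Within⇒Star : ∀ k {v r} → Within k v r → Star (Adj G) v r
  Within⇒Star zero    refl               = ε
  Within⇒Star (suc k) (inj₁ w)           = Within⇒Star k w
  Within⇒Star (suc k) (inj₂ (_ , a , w)) = a ◅ Within⇒Star k w

  Path⇒Within : ∀ {v vs r} → Path (Adj G) v vs r → Within (length vs) v r
  Path⇒Within []           = refl
  Path⇒Within (step a _ p) = inj₂ (_ , a , Path⇒Within p)

  -- A simple path has at most `n` vertices, so the bound `n` captures all of reachability.
  Star⇒Within : ∀ {v r} → Star (Adj G) v r → Within n v r
  Star⇒Within walk with Star⇒Path walk
  ... | vs , p = Within-mono (≤-trans (n≤1+n _) length≤n) (Path⇒Within p)
    where
    length≤n : suc (length vs) ≤ n
    length≤n = Unique⇒length≤ (Path-unique p) (λ {x} _ → x) (λ _ _ → id)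

  -- The reachable vertex of least number is the same throughout a component, which makes it a
  -- canonical root.
  leastReachable : ∀ v → ∃ λ i → (∃ λ r → toℕ r ≡ i × Within n v r) ×
                         (∀ {j} → (∃ λ r → toℕ r ≡ j × Within n v r) → i ≤ j)
  leastReachable v = least (λ i → any? λ r → (toℕ r ≟ i) ×-dec within? n v r)
                       (toℕ v) (v , refl , Star⇒Within ε)

  root′ : Fin n → Fin n
  root′ v = proj₁ (proj₁ (proj₂ (leastReachable v)))

  Within-root : ∀ v → Within n v (root′ v)
  Within-root v = proj₂ (proj₂ (proj₁ (proj₂ (leastReachable v))))

  root-least : ∀ {v r} → Within n v r → toℕ (root′ v) ≤ toℕ r
  root-least {v} {r} w =
    subst (_≤ toℕ r) (sym (proj₁ (proj₂ (proj₁ (proj₂ (leastReachable v))))))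
      (proj₂ (proj₂ (leastReachable v)) (r , refl , w))

  root′-adj : ∀ {u v} → Adj G u v → root′ u ≡ root′ v
  root′-adj {u} {v} uv = toℕ-injective (≤-antisym (le uv) (le (Adj-sym G uv)))
    where
    le : ∀ {u v} → Adj G u v → toℕ (root′ u) ≤ toℕ (root′ v)
    le {u} {v} uv = root-least (Star⇒Within (uv ◅ Within⇒Star n (Within-root v)))

  distance : ∀ v → ∃ λ k → Within k v (root′ v) × (∀ {j} → Within j v (root′ v) → k ≤ j)
  distance v = least (λ k → within? k v (root′ v)) n (Within-root v)

  depth′ : Fin n → ℕ
  depth′ v = proj₁ (distance v)

  depth′-adj : ∀ {u v} → Adj G u v → depth′ v ≤ suc (depth′ u)
  depth′-adj {u} {v} uv = proj₂ (proj₂ (distance v))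
    (inj₂ (u , Adj-sym G uv , subst (Within _ u) (root′-adj uv) (proj₁ (proj₂ (distance u)))))

  -- The first disjunct of `Within` would contradict minimality, so a shortest walk starts with an
  -- edge; the rest of it is shortest for the neighbour, whose root is the same.
  closer : ∀ v {k} → depth′ v ≡ suc k → ∃ λ u → Adj G v u × depth′ u ≡ k
  closer v {k} eq with distance v
  closer v {k} refl | _ , inj₁ w , minimal = contradiction (minimal w) 1+n≰n
  closer v {k} refl | _ , inj₂ (u , vu , w) , minimal =
    u , vu , ≤-antisym (proj₂ (proj₂ (distance u)) (subst (Within k u) (root′-adj vu) w))
               (s≤s⁻¹ (minimal (inj₂ (u , vu ,
                 subst (Within _ u) (sym (root′-adj vu)) (proj₁ (proj₂ (distance u)))))))

  -- The vertex itself is the default at depth 0. The depth is a separate argument so that it can be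
  -- matched on.
  parentAt : ∀ v k → depth′ v ≡ k → Fin n
  parentAt v zero    _  = v
  parentAt v (suc k) eq = proj₁ (closer v eq)

  parentAt-spec : ∀ v k (eq : depth′ v ≡ k) {l} → k ≡ suc l →
                  Adj G v (parentAt v k eq) × depth′ (parentAt v k eq) ≡ l
  parentAt-spec v (suc k) eq refl = proj₂ (closer v eq)

  layering : Layering G
  layering = record
    { depth        = depth′
    ; root         = root′
    ; parent       = λ v → parentAt v _ refl
    ; root-adj     = root′-adj
    ; depth-adj    = depth′-adj
    ; depth-zero   = λ {v} eq → subst (λ k → Within k v (root′ v)) eq (proj₁ (proj₂ (distance v)))
    ; parent-adj   = λ {v} eq → proj₁ (parentAt-spec v _ refl eq)
    ; depth-parent = λ {v} eq → proj₂ (parentAt-spec v _ refl eq)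
    }

-- Colouring along a layering

parity : ℕ → Bool
parity zero    = false
parity (suc k) = not (parity k)

SameEdge-sym : {V : Set} {u v a b : V} → SameEdge u v a b → SameEdge v u a b
SameEdge-sym (inj₁ (p , q)) = inj₂ (q , p)
SameEdge-sym (inj₂ (p , q)) = inj₁ (q , p)

SameEdge-ordered : ∀ {n} {u v u′ v′ a b : Fin n} → toℕ u < toℕ v → toℕ u′ < toℕ v′ →
                   SameEdge u v a b → SameEdge u′ v′ a b → (u , v) ≡ (u′ , v′)
SameEdge-ordered _   _    (inj₁ (refl , refl)) (inj₁ (refl , refl)) = refl
SameEdge-ordered u<v v<u  (inj₁ (refl , refl)) (inj₂ (refl , refl)) = contradiction u<v (<-asym v<u)
SameEdge-ordered u<v v<u  (inj₂ (refl , refl)) (inj₁ (refl , refl)) = contradiction u<v (<-asym v<u)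
SameEdge-ordered _   _    (inj₂ (refl , refl)) (inj₂ (refl , refl)) = refl

module Colouring {n} (G : Graph n) (L : Layering G) (disjoint : OddCyclesEdgeDisjoint G) where

  open Layering L
  open OddCycleThrough

  -- Horizontal and vertical edges.

  Vertical : Fin n → Fin n → Set
  Vertical u v = Adj G u v × depth u ≢ depth v

  Horizontal : Fin n → Fin n → Set
  Horizontal u v = Adj G u v × depth u ≡ depth v

  Vertical-sym : Symmetric Vertical
  Vertical-sym (uv , ≢) = Adj-sym G uv , ≢ ∘ sym

  Horizontal-sym : Symmetric Horizontal
  Horizontal-sym (uv , ≡) = Adj-sym G uv , sym ≡

  vertical-depth : ∀ {u v} → Vertical u v → depth v ≡ suc (depth u) ⊎ depth u ≡ suc (depth v)
  vertical-depth {u} {v} (uv , u≢v) with <-cmp (depth u) (depth v)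
  ... | tri< u<v _ _ = inj₁ (≤-antisym (depth-adj uv) u<v)
  ... | tri≈ _ u≡v _ = contradiction u≡v u≢v
  ... | tri> _ _ v<u = inj₂ (≤-antisym (depth-adj (Adj-sym G uv)) v<u)

  vertical-parity : ∀ {u v} → Vertical u v → parity (depth u) ≢ parity (depth v)
  vertical-parity uv eq with vertical-depth uv
  ... | inj₁ v≡1+u = Bool.not-¬ (sym eq) (cong parity v≡1+u)
  ... | inj₂ u≡1+v = Bool.not-¬ eq (cong parity u≡1+v)

  IsParent : Fin n → Fin n → Set
  IsParent x p = Adj G x p × depth x ≡ suc (depth p)

  IsParent⇒Vertical : ∀ {x p} → IsParent x p → Vertical x p
  IsParent⇒Vertical (xp , eq) = xp , λ eq′ → 1+n≢n (trans (sym eq) eq′)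

  isParent : ∀ {x k} → depth x ≡ suc k → IsParent x (parent x)
  isParent eq = parent-adj eq , trans eq (cong suc (sym (depth-parent eq)))

  -- At depth 0 both ends would equal their common root, so the depth is positive.
  horizontal-isParent : ∀ {x y} → Horizontal x y → IsParent x (parent x)
  horizontal-isParent {x} {y} (xy , eq) = helper (depth x) refl
    where
    helper : ∀ k → depth x ≡ k → IsParent x (parent x)
    helper zero    x≡0 = contradiction
      (trans (depth-zero x≡0) (trans (root-adj xy) (sym (depth-zero (trans (sym eq) x≡0)))))
      (Adj⇒≢ G xy)
    helper (suc k) x≡1+k = isParent x≡1+k

  cycleThrough : {R : Fin n → Fin n → Set} → Symmetric R → (∀ {u v} → R u v → Vertical u v) →
                 ∀ {x y} → Horizontal x y → Star R x y → OddCycleThrough G R x y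
  cycleThrough R-sym R⇒V (xy , eq) =
    oddCycleThrough G R-sym (proj₁ ∘ R⇒V) (parity ∘ depth) (vertical-parity ∘ R⇒V)
      xy (cong parity eq)

  sameCycle : ∀ {R R′ x y x′ y′ u v} (C : OddCycleThrough G R x y) (C′ : OddCycleThrough G R′ x′ y′) →
              EdgeOf (cycle C) u v → EdgeOf (cycle C′) u v → SameCycle (cycle C) (cycle C′)
  sameCycle C C′ e e′ = disjoint (cycle C) (cycle C′) (odd C) (odd C′) (_ , _ , e , e′)

  horizontal-edge : ∀ {R x y u v} → (∀ {u v} → R u v → Vertical u v) → (C : OddCycleThrough G R x y) →
                    Horizontal u v → EdgeOf (cycle C) u v → SameEdge u v x y
  horizontal-edge R⇒V C (_ , eq) e with edge⇒R C e
  ... | inj₁ r = contradiction eq (proj₂ (R⇒V r))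
  ... | inj₂ s = s

  -- Vertical walks avoiding a vertex or an edge.

  NotAt : Fin n → Fin n → Fin n → Set
  NotAt x u v = Vertical u v × u ≢ x × v ≢ x

  NotAt-sym : ∀ {x} → Symmetric (NotAt x)
  NotAt-sym (uv , u≢x , v≢x) = Vertical-sym uv , v≢x , u≢x

  -- Ensures that the chain of parents from `u` never meets `x`: after the first step it lies
  -- strictly above the layer of `x`.
  Above : Fin n → Fin n → Set
  Above x u = depth u ≤ depth x × u ≢ x

  IsParent⇒Above : ∀ {x u p} → depth u ≤ depth x → IsParent u p → Above x p
  IsParent⇒Above {x} {u} {p} u≤x (_ , eq) = <⇒≤ p<x , λ p≡x → <⇒≢ p<x (cong depth p≡x)
    where
    p<x : depth p < depth x
    p<x = subst (_≤ depth x) eq u≤x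

  climb : ∀ {x} k {u} → depth u ≡ k → Above x u → Star (NotAt x) u (root u)
  climb {x} zero    {u} eq _ = subst (Star (NotAt x) u) (depth-zero eq) ε
  climb {x} (suc k) {u} eq (u≤x , u≢x) = (IsParent⇒Vertical up , u≢x , proj₂ above) ◅
    subst (Star (NotAt x) (parent u)) (sym (root-adj (proj₁ up))) (climb k (depth-parent eq) above)
    where
    up : IsParent u (parent u)
    up = isParent eq
    above : Above x (parent u)
    above = IsParent⇒Above u≤x up

  connect : ∀ {x a b} → Above x a → Above x b → root a ≡ root b → Star (NotAt x) a b
  connect {x} {a} a↑ b↑ eq = subst (Star (NotAt x) a) eq (climb _ refl a↑)
    ◅◅ Star.reverse NotAt-sym (climb _ refl b↑)

  Horizontal⇒Above : ∀ {x y} → Horizontal x y → Above x y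
  Horizontal⇒Above (xy , eq) = ≤-reflexive (sym eq) , Adj⇒≢ G xy ∘ sym

  parent-root : ∀ {x p y} → IsParent x p → Adj G x y → root p ≡ root y
  parent-root (xp , _) xy = trans (sym (root-adj xp)) (root-adj xy)

  abstract
    -- The walk steps from `x` to `p`, climbs to the root and descends to `y`, never returning to
    -- `x`.
    parentCycle : ∀ {x y p} → Horizontal x y → IsParent x p →
                  Σ (OddCycleThrough G Vertical x y) λ C → EdgeOf (cycle C) x p
    parentCycle {x} {y} {p} xy xp = weaken , viaParent (first C)
      where
      -- The only `Via`-edge at `x` is `xp`, so the cycle keeps this edge after loop erasure.
      Via : Fin n → Fin n → Set
      Via u v = Vertical u v × (u ≡ x → v ≡ p) × (v ≡ x → u ≡ p)

      p↑ : Above x p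
      p↑ = IsParent⇒Above ≤-refl xp

      C : OddCycleThrough G Via x y
      C = cycleThrough (λ (uv , f , g) → Vertical-sym uv , g , f) proj₁ xy
        ((IsParent⇒Vertical xp , (λ _ → refl) , λ p≡x → contradiction p≡x (proj₂ p↑)) ◅
         Star.map (λ (uv , u≢x , v≢x) → uv , (λ e → contradiction e u≢x) , λ e → contradiction e v≢x)
           (connect p↑ (Horizontal⇒Above xy) (parent-root xp (proj₁ xy))))

      weaken : OddCycleThrough G Vertical x y
      weaken = record
        { cycle   = cycle C
        ; odd     = odd C
        ; closing = closing C
        ; edge⇒R  = [ inj₁ ∘ proj₁ , inj₂ ]′ ∘ edge⇒R C
        ; first   = let q , r , e = first C in q , proj₁ r , e
        ; path    = Star.map (λ (r , e) → proj₁ r , e) (path C)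
        }

      viaParent : (∃ λ q → Via x q × EdgeOf (cycle C) x q) → EdgeOf (cycle C) x p
      viaParent (q , (_ , x⇒p , _) , e) = subst (EdgeOf (cycle C) x) (x⇒p refl) e

  Avoiding : Fin n → Fin n → Fin n → Fin n → Set
  Avoiding a b u v = Vertical u v × ¬ SameEdge u v a b

  Avoiding-sym : ∀ {a b} → Symmetric (Avoiding a b)
  Avoiding-sym (uv , ≢) = Vertical-sym uv , ≢ ∘ SameEdge-sym

  NotAt⇒Avoiding : ∀ {x p u v} → NotAt x u v → Avoiding x p u v
  NotAt⇒Avoiding (uv , u≢x , v≢x) = uv , λ where
    (inj₁ (u≡x , _)) → u≢x u≡x
    (inj₂ (_ , v≡x)) → v≢x v≡x

  -- Such a walk and a walk through p would close up to two odd cycles sharing xy, of which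
  -- only one contains xp.
  parentEdge-unavoidable : ∀ {x y p} → Horizontal x y → IsParent x p → ¬ Star (Avoiding x p) x y
  parentEdge-unavoidable {x} {y} {p} xy xp walk
    with C , xp∈C ← parentCycle xy xp
    with D ← cycleThrough Avoiding-sym proj₁ xy walk
    with edge⇒R D (Equivalence.to (sameCycle C D (closing C) (closing D) x p) xp∈C)
  ... | inj₁ (_ , avoids)      = avoids (inj₁ (refl , refl))
  ... | inj₂ (inj₁ (_ , refl)) = proj₂ (IsParent⇒Vertical xp) (proj₂ xy)
  ... | inj₂ (inj₂ (refl , _)) = Adj⇒≢ G (proj₁ xy) refl

  -- A second parent `q` would start a walk from `x` to `y` avoiding the edge `xp`.
  parent-unique : ∀ {x y p q} → Horizontal x y → IsParent x p → IsParent x q → q ≡ p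
  parent-unique {x} {y} {p} {q} xy xp xq with q ≟ᶠ p
  ... | yes q≡p = q≡p
  ... | no q≢p  = contradiction
    ((IsParent⇒Vertical xq , λ where
       (inj₁ (_ , q≡p))    → q≢p q≡p
       (inj₂ (_ , refl)) → proj₂ (IsParent⇒Above ≤-refl xq) refl) ◅
     Star.map NotAt⇒Avoiding
       (connect (IsParent⇒Above ≤-refl xq) (Horizontal⇒Above xy) (parent-root xq (proj₁ xy))))
    (parentEdge-unavoidable xy xp)

  -- The odd cycles through `xy` and `xy′` share the edge from `x` to `parent x`, so they coincide,
  -- and such a cycle has only one horizontal edge.
  horizontal-unique : ∀ {x y y′} → Horizontal x y → Horizontal x y′ → y ≡ y′
  horizontal-unique {x} {y} xy xy′
    with C , e  ← parentCycle xy  (horizontal-isParent xy)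
    with D , e′ ← parentCycle xy′ (horizontal-isParent xy′)
    with horizontal-edge id D xy (Equivalence.to (sameCycle C D e e′ x y) (closing C))
  ... | inj₁ (_ , y≡y′) = y≡y′
  ... | inj₂ (_ , y≡x)  = contradiction (sym y≡x) (Adj⇒≢ G (proj₁ xy))

  -- The independent set.

  Small : Fin n → Set
  Small x = ∃ λ y → Horizontal x y × toℕ x < toℕ y

  small? : ∀ x → Dec (Small x)
  small? x = any? λ y → ((adj G x y Bool.≟ true) ×-dec (depth x ≟ depth y)) ×-dec (toℕ x <? toℕ y)

  -- The first argument stands for the depth of `v` and makes the recursion along parents
  -- structural. Roots stay outside the set.
  stateAt : ℕ → Fin n → Bool
  stateAt zero    v = false
  stateAt (suc k) v = if does (small? v) then false else not (stateAt k (parent v))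

  state : Fin n → Bool
  state v = stateAt (depth v) v

  state-small : ∀ {v} → Small v → state v ≡ false
  state-small {v} s = helper (depth v)
    where
    helper : ∀ k → stateAt k v ≡ false
    helper zero = refl
    helper (suc k) rewrite dec-true (small? v) s = refl

  state-parent : ∀ {v k} → depth v ≡ suc k → ¬ Small v → state v ≡ not (state (parent v))
  state-parent {v} {k} eq ¬s = trans (cong (λ d → stateAt d v) eq)
    (trans unfold (cong (λ d → not (stateAt d (parent v))) (sym (depth-parent eq))))
    where
    unfold : stateAt (suc k) v ≡ not (stateAt k (parent v))
    unfold rewrite dec-false (small? v) ¬s = refl

  -- The double negation lets parents of a horizontal edge be linked without deciding
  -- which edges lie on a cycle; only refutations are ever drawn from Linked.
  Linked : Fin n → Fin n → Set
  Linked a b = ∀ {v} → Small v → depth v ≤ depth a → ¬ ¬ Star (Avoiding v (parent v)) a b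

  Linked-sym : ∀ {a b} → depth a ≡ depth b → Linked a b → Linked b a
  Linked-sym eq link {v} s v≤b ¬walk =
    link s (subst (depth v ≤_) (sym eq) v≤b) (¬walk ∘ Star.reverse Avoiding-sym)

  -- If `a` were small, with horizontal edge `ay`, a walk to `b` avoiding its parent edge would
  -- extend to `y` without meeting `a` again after `b`, contrary to `parentEdge-unavoidable`.
  linked⇒¬small : ∀ {a b} → a ≢ b → depth a ≡ depth b → root a ≡ root b → Linked a b → ¬ Small a
  linked⇒¬small a≢b eq req link s@(_ , ay , _) = link s ≤-refl λ walk →
    parentEdge-unavoidable ay (horizontal-isParent ay) (walk ◅◅ Star.map NotAt⇒Avoiding
      (connect (≤-reflexive (sym eq) , a≢b ∘ sym) (Horizontal⇒Above ay)
        (trans (sym req) (root-adj (proj₁ ay)))))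

  -- The deeper end of `ap` is `a`, that of the parent edge of `v` is `v`, and their depths differ.
  deep⇒Avoiding : ∀ {v a p} → Small v → depth v < depth a → IsParent a p → Avoiding v (parent v) a p
  deep⇒Avoiding (_ , vy , _) v<a ap = IsParent⇒Vertical ap , λ where
    (inj₁ (refl , _)) → <-irrefl refl v<a
    (inj₂ (refl , refl)) → <-asym v<a (≤-reflexive (sym (proj₂ (horizontal-isParent vy))))

  -- Induction on the depth. Distinct linked vertices are not small, so both states negate those of
  -- the parents, and the parents are again linked through the two parent edges.
  linked⇒state≡ : ∀ k {a b} → depth a ≡ k → depth b ≡ k → root a ≡ root b →
                  Linked a b → state a ≡ state b
  linked⇒state≡ k {a} {b} ak bk req link with a ≟ᶠ b
  ... | yes refl = refl
  linked⇒state≡ zero    ak bk req link | no a≢b =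
    contradiction (trans (depth-zero ak) (trans req (sym (depth-zero bk)))) a≢b
  linked⇒state≡ (suc k) {a} {b} ak bk req link | no a≢b =
    trans (state-parent ak (linked⇒¬small a≢b a≡b req link))
      (trans (cong not (linked⇒state≡ k (depth-parent ak) (depth-parent bk) preq plink))
        (sym (state-parent bk
          (linked⇒¬small (a≢b ∘ sym) (sym a≡b) (sym req) (Linked-sym a≡b link)))))
    where
    a≡b : depth a ≡ depth b
    a≡b = trans ak (sym bk)
    ap : IsParent a (parent a)
    ap = isParent ak
    bp : IsParent b (parent b)
    bp = isParent bk
    preq : root (parent a) ≡ root (parent b)
    preq = trans (sym (root-adj (proj₁ ap))) (trans req (root-adj (proj₁ bp)))
    plink : Linked (parent a) (parent b)
    plink {v} s v≤pa ¬walk = link s (<⇒≤ v<a) λ walk →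
      ¬walk (Avoiding-sym (deep⇒Avoiding s v<a ap) ◅
        (walk ◅◅ (deep⇒Avoiding s (subst (depth v <_) a≡b v<a) bp ◅ ε)))
      where
      v<a : depth v < depth a
      v<a = subst (depth v <_) (sym (proj₂ ap)) (s≤s v≤pa)

  -- The walk `p`, `w`, `q` links the two parents. This frees `state` from the arbitrary choice of
  -- `parent`.
  parents-state : ∀ {w p q} → IsParent w p → IsParent w q → state p ≡ state q
  parents-state {w} {p} {q} wp wq = linked⇒state≡ (depth p) refl
    (suc-injective (trans (sym (proj₂ wq)) (proj₂ wp)))
    (parent-root wp (proj₁ wq))
    λ {v} s v≤p ¬walk → let v<w = subst (depth v <_) (sym (proj₂ wp)) (s≤s v≤p) in
      ¬walk (Avoiding-sym (deep⇒Avoiding s v<w wp) ◅ deep⇒Avoiding s v<w wq ◅ ε)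

  -- The parents are linked along the vertical part of the odd cycle of `xy`. Were the parent edge
  -- of a small `v` above `x` on it, it would also be the odd cycle of the horizontal edge at `v`,
  -- which lies in another layer than `xy`.
  horizontal-parents-state : ∀ {x y} → Horizontal x y → state (parent x) ≡ state (parent y)
  horizontal-parents-state {x} {y} xy@(adj-xy , eq) = linked⇒state≡ (depth (parent x)) refl
    (suc-injective (trans (sym (proj₂ yp)) (trans (sym eq) (proj₂ xp))))
    (trans (parent-root xp adj-xy) (root-adj (proj₁ yp))) link
    where
    xp : IsParent x (parent x)
    xp = horizontal-isParent xy
    yp : IsParent y (parent y)
    yp = horizontal-isParent (Horizontal-sym xy)
    C : OddCycleThrough G Vertical x y
    C = proj₁ (parentCycle xy xp)
    link : Linked (parent x) (parent y)
    link {v} s@(v′ , vv′ , _) v≤px ¬walk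
      with D , vp∈D ← parentCycle vv′ (horizontal-isParent vv′) =
      ¬walk (Avoiding-sym (deep⇒Avoiding s v<x xp) ◅
        (Star.map avoiding (path C) ◅◅ (deep⇒Avoiding s (subst (depth v <_) eq v<x) yp ◅ ε)))
      where
      v<x : depth v < depth x
      v<x = subst (depth v <_) (sym (proj₂ xp)) (s≤s v≤px)
      vp∉C : ¬ EdgeOf (cycle C) v (parent v)
      vp∉C vp∈C with horizontal-edge id D xy (Equivalence.to (sameCycle C D vp∈C vp∈D x y) (closing C))
      ... | inj₁ (refl , _) = <-irrefl refl v<x
      ... | inj₂ (_ , refl) = <-irrefl (sym eq) v<x
      avoiding : ∀ {a b} → Vertical a b × EdgeOf (cycle C) a b → Avoiding v (parent v) a b
      avoiding (ab , e) = ab , λ where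
        (inj₁ (refl , refl)) → vp∉C e
        (inj₂ (refl , refl)) → vp∉C (EdgeOf-sym (cycle C) e)

  -- Charging mono-indexed edges to odd cycles.

  data Classified (u v : Fin n) : Set where
    horizontal : ∀ {x y} → Horizontal x y → toℕ x < toℕ y → SameEdge u v x y → Classified u v
    vertical   : ∀ {x p} → IsParent x p → SameEdge u v x p → Classified u v

  classify : ∀ {u v} → Adj G u v → Classified u v
  classify {u} {v} uv with depth u ≟ depth v
  classify {u} {v} uv | yes eq with <-cmp (toℕ u) (toℕ v)
  ... | tri< u<v _ _ = horizontal (uv , eq) u<v (inj₁ (refl , refl))
  ... | tri≈ _ u≡v _ = contradiction (toℕ-injective u≡v) (Adj⇒≢ G uv)
  ... | tri> _ _ v<u = horizontal (Adj-sym G uv , sym eq) v<u (inj₂ (refl , refl))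
  classify {u} {v} uv | no ≢ with vertical-depth (uv , ≢)
  ... | inj₁ v≡1+u = vertical (Adj-sym G uv , v≡1+u) (inj₂ (refl , refl))
  ... | inj₂ u≡1+v = vertical (uv , u≡1+v) (inj₁ (refl , refl))

  vertical-state : ∀ {x p} → IsParent x p → ¬ Small x → state x ≡ not (state p)
  vertical-state xp ¬s = trans (state-parent (proj₂ xp) ¬s)
    (cong not (parents-state (isParent (proj₂ xp)) xp))

  SameEdge-state : ∀ {u v a b c} → SameEdge u v a b → state u ≡ c → state v ≡ c →
                   state a ≡ c × state b ≡ c
  SameEdge-state (inj₁ (refl , refl)) u v = u , v
  SameEdge-state (inj₂ (refl , refl)) u v = v , u

  true≢false : true ≢ false
  true≢false ()

  state-independent : ∀ {u v} → Adj G u v → state u ≡ true → state v ≡ true → ⊥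
  state-independent uv su sv with classify uv
  ... | horizontal xy x<y e =
    true≢false (trans (sym (proj₁ (SameEdge-state e su sv))) (state-small (_ , xy , x<y)))
  ... | vertical {x} xp e with SameEdge-state e su sv | small? x
  ...   | sx , _  | yes s = true≢false (trans (sym sx) (state-small s))
  ...   | sx , sp | no ¬s = true≢false (trans (sym sx) (trans (vertical-state xp ¬s) (cong not sp)))

  -- The clause `state y ≡ true` makes the two kinds exclusive: the first occurs for edges with both
  -- ends outside the set, hence with `state y ≡ false`.
  record Charged (u v : Fin n) : Set where
    constructor charged
    field
      {x y} : Fin n
      xy    : Horizontal x y
      x<y   : toℕ x < toℕ y
      kind  : SameEdge u v x y ⊎ (SameEdge u v x (parent x) × state y ≡ true)

  abstract
    -- On a vertical edge the child must be small, and `p` is then its only parent. The other end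
    -- `y` is not small, so its state negates that of `parent y`, which equals that of `p`.
    charge : ∀ {u v} → Adj G u v → state u ≡ false → state v ≡ false → Charged u v
    charge uv su sv with classify uv
    ... | horizontal xy x<y e = charged xy x<y (inj₁ e)
    ... | vertical {x} xp e with SameEdge-state e su sv | small? x
    ...   | sx , sp | no ¬s = contradiction
      (trans (cong not (sym sp)) (trans (sym (vertical-state xp ¬s)) sx)) true≢false
    ...   | sx , sp | yes (y , xy , x<y) with parent-unique xy (horizontal-isParent xy) xp
    ...     | refl = charged xy x<y (inj₂ (e ,
      trans (state-parent (proj₂ (horizontal-isParent (Horizontal-sym xy))) y-large)
        (cong not (trans (sym (horizontal-parents-state xy)) sp))))
      where
      y-large : ¬ Small y
      y-large (z , yz , y<z) with refl ← horizontal-unique (Horizontal-sym xy) yz = <-asym x<y y<z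

  open IndependentLabelling G state state-independent public

  -- Each mono-indexed edge is sent to the position in `Cs` of the odd cycle to which it is charged.
  monoEdges≤oddCycles : (Cs : List (Cycle G)) →
    (∀ (C : Cycle G) → OddCycle C → Σ (Cycle G) λ D → D ∈ Cs × SameCycle C D) →
    monoEdges labelling ≤ length Cs
  monoEdges≤oddCycles Cs complete = subst (_≤ length Cs) (sym (monoEdges≡ labelling))
    (Unique⇒length≤ (monoEdgeList-unique labelling) (cycleIndex ∘ chargeOf) injective)
    where
    open Charged

    ordered : ∀ {e} → e ∈ monoEdgeList labelling → toℕ (proj₁ e) < toℕ (proj₂ e)
    ordered e∈ = proj₂ (∈-edges⁻ G (proj₁ (∈-monoEdgeList⁻ labelling e∈)))

    states : ∀ {e} → e ∈ monoEdgeList labelling → state (proj₁ e) ≡ false × state (proj₂ e) ≡ false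
    states e∈ = let e∈G , mono = ∈-monoEdgeList⁻ labelling e∈ in mono⇒false (proj₁ (∈-edges⁻ G e∈G)) mono

    chargeOf : ∀ {e} → e ∈ monoEdgeList labelling → Charged (proj₁ e) (proj₂ e)
    chargeOf e∈ = let su , sv = states e∈ in
      charge (proj₁ (∈-edges⁻ G (proj₁ (∈-monoEdgeList⁻ labelling e∈)))) su sv

    cycleOf : ∀ {u v} (c : Charged u v) → OddCycleThrough G Vertical (x c) (y c)
    cycleOf c = proj₁ (parentCycle (xy c) (horizontal-isParent (xy c)))

    listed : ∀ {u v} (c : Charged u v) → Σ (Cycle G) λ D → D ∈ Cs × SameCycle (cycle (cycleOf c)) D
    listed c = complete (cycle (cycleOf c)) (odd (cycleOf c))

    cycleIndex : ∀ {u v} → Charged u v → Fin (length Cs)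
    cycleIndex c = Any.index (proj₁ (proj₂ (listed c)))

    -- The cycle determines its single horizontal edge, and `x<y` fixes the orientation.
    cycleIndex-injective : ∀ {u v u′ v′} (c : Charged u v) (c′ : Charged u′ v′) →
                           cycleIndex c ≡ cycleIndex c′ → (x c , y c) ≡ (x c′ , y c′)
    cycleIndex-injective c c′ eq with listed c | listed c′
    ... | D , D∈ , same | D′ , D′∈ , same′ with refl ← index-injective D∈ D′∈ eq =
      SameEdge-ordered (x<y c) (x<y c′)
        (horizontal-edge id (cycleOf c′) (xy c)
          (Equivalence.from (same′ (x c) (y c)) (Equivalence.to (same (x c) (y c)) (closing (cycleOf c)))))
        (inj₁ (refl , refl))

    kind-injective : ∀ {u v u′ v′} → toℕ u < toℕ v → toℕ u′ < toℕ v′ →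
      state u ≡ false × state v ≡ false → state u′ ≡ false × state v′ ≡ false →
      (c : Charged u v) (c′ : Charged u′ v′) → (x c , y c) ≡ (x c′ , y c′) → (u , v) ≡ (u′ , v′)
    kind-injective u<v u′<v′ _ _ (charged _ _ (inj₁ e)) (charged _ _ (inj₁ e′)) refl =
      SameEdge-ordered u<v u′<v′ e e′
    kind-injective u<v u′<v′ _ _ (charged _ _ (inj₂ (e , _))) (charged _ _ (inj₂ (e′ , _))) refl =
      SameEdge-ordered u<v u′<v′ e e′
    kind-injective _ _ (su , sv) _ (charged _ _ (inj₁ e)) (charged _ _ (inj₂ (_ , sy))) refl =
      contradiction (trans (sym sy) (proj₂ (SameEdge-state e su sv))) true≢false
    kind-injective _ _ _ (su , sv) (charged _ _ (inj₂ (_ , sy))) (charged _ _ (inj₁ e)) refl =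
      contradiction (trans (sym sy) (proj₂ (SameEdge-state e su sv))) true≢false

    injective : ∀ {e e′} (e∈ : e ∈ monoEdgeList labelling) (e′∈ : e′ ∈ monoEdgeList labelling) →
                cycleIndex (chargeOf e∈) ≡ cycleIndex (chargeOf e′∈) → e ≡ e′
    injective e∈ e′∈ eq = kind-injective (ordered e∈) (ordered e′∈) (states e∈) (states e′∈)
      (chargeOf e∈) (chargeOf e′∈) (cycleIndex-injective (chargeOf e∈) (chargeOf e′∈) eq)

theorem4p3 : ∀ {n : ℕ} (G : Graph n) → Entwined G → OddCyclesEdgeDisjoint G →
    (Cs : List (Cycle G)) → ListsOddCycles G Cs →
    ((f : WeakIASI G) → length Cs ≤ monoEdges f) ×
    (Σ (WeakIASI G) λ f → monoEdges f ≡ length Cs)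
theorem4p3 G _ disjoint Cs (odd , complete , distinct) =
  -- The lower bound holds for every weak set-indexer, in particular for `labelling`, where it meets
  -- the upper bound.
  lower , labelling , ≤-antisym (monoEdges≤oddCycles Cs complete) (lower labelling)
  where
  open Colouring G (layering G) disjoint
  lower : (f : WeakIASI G) → length Cs ≤ monoEdges f
  lower f = LowerBound.oddCycles≤monoEdges f disjoint Cs odd distinct
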